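{- Let $S \subseteq [p]$ with $|S| = m$, and let $a, b \in [p]$. If $(ax + b) \bmod p \in S$ for all $x \in [m]$, then $$\mathbf{E}\bigl[\mathbf{lbin}(S)\bigr] = O(1).$$
   Context: For a non-negative integer $k$, $[k] = \{0, 1, \dots, k-1\}$. $p$ is a fixed prime and $m$ is the number of bins, which equals the number of balls $|S|$. For $\alpha, \beta \in [p]$ the function $h_{\alpha,\beta} : [p] \to [m]$ is $h_{\alpha,\beta}(x) = ((\alpha x+\beta) \bmod p) \bmod m$. For $S \subseteq [p]$ put $\mathbf{bin}(h_{\alpha,\beta}, S, i) = |S \cap h_{\alpha,\beta}^{ -1}(i)|$ for $i \in [m]$ and $\mathbf{lbin}(h_{\alpha,\beta}, S) = \max_{i \in [m]} \mathbf{bin}(h_{\alpha,\beta}, S, i)$. The random variable $\mathbf{lbin}(S)$ is $\mathbf{lbin}(h_{\alpha,\beta}, S)$ with $(\alpha,\beta)$ chosen uniformly from $[p]^2$ (the $a,b$ in the claim are fixed and unrelated to this random choice). $O(1)$ means bounded by an absolute constant.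
   Formalization: The formal statement adds the hypothesis a ≠ 0: for a = 0 the condition only says b ∈ S, leaving S otherwise arbitrary, and the O(1) bound then fails (random S, p large); m ≥ 1 is also assumed so that "mod m" makes sense. -}

module Defs where

open import Data.Fin.Base using (Fin; toℕ)
open import Data.Fin.Properties using (_≟_)
open import Data.Fin.Subset using (Subset; _∩_; ∣_∣)
open import Data.Integer.Base using (+_)
open import Data.List.Base using (allFin; map)
open import Data.List.Extrema.Nat using (max)
open import Data.Nat.Base using (ℕ; NonZero; _+_; _*_; _^_)
open import Data.Nat.DivMod using (_%_; _mod_)
open import Data.Nat.ListAction using (sum)
open import Data.Nat.Properties using (m^n≢0)
open import Data.Rational.Base using (ℚ; _/_)
open import Data.Vec.Base using (tabulate)
open import Relation.Nullary.Decidable using (does)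

hash : (p m : ℕ) .{{_ : NonZero p}} .{{_ : NonZero m}} →
       (α β : Fin p) → Fin p → Fin m
hash p m α β x = ((toℕ α * toℕ x + toℕ β) % p) mod m

preimage : ∀ {p m} → (Fin p → Fin m) → Fin m → Subset p
preimage h i = tabulate λ x → does (h x ≟ i)

bin : ∀ {p m} → (Fin p → Fin m) → Subset p → Fin m → ℕ
bin h S i = ∣ S ∩ preimage h i ∣

-- The default value 0 does not affect the maximum when m > 0.
lbin : ∀ {p m} → (Fin p → Fin m) → Subset p → ℕ
lbin {m = m} h S = max 0 (map (bin h S) (allFin m))

-- Expectation of X α β for (α , β) uniform on [p]².
𝔼 : (p : ℕ) .{{_ : NonZero p}} → (Fin p → Fin p → ℕ) → ℚ
𝔼 p X = _/_ (+ sum (map (λ α → sum (map (X α) (allFin p))) (allFin p)))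
            (p ^ 2) {{m^n≢0 p 2}}

𝔼-lbin : (p m : ℕ) .{{_ : NonZero p}} .{{_ : NonZero m}} → Subset p → ℚ
𝔼-lbin p m S = 𝔼 p λ α β → lbin (hash p m α β) S

{-# OPTIONS --safe #-}

-- S is the image of [m] under x ↦ (a x + b) mod p. For α ≠ 0 put A = α a; the
-- elements of S in bin c correspond to points (x , t) with x < m, t ≤ (p - 1) / m
-- and A x + B ≡ c + m t mod p, i.e. to points of a translate of the lattice
-- {(d , t) | A d ≡ m t mod p}, of determinant p, in a box of area < p. A triangle
-- in the box has area < p / 2, so all the points of a bin are collinear. If there
-- are K + 1 of them, the pigeonhole principle gives a lattice vector (d , ± e)
-- with 0 < d ≤ (m - 1) / K and e ≤ (p - 1) / (m K), and then e > 0 since p ∤ A.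
-- A given vector belongs to the lattice of at most one α, so at most 2 p / L²
-- values α ≠ 0 give a load above L, and Σ 1 / L² converges.
module Submission where

open import Defs
open import Data.Fin.Base as Fin using (Fin; zero; suc; toℕ; fromℕ<)
open import Data.Fin.Properties as Fin
  using (any?; pigeonhole; fromℕ<-injective; toℕ-fromℕ<; toℕ<n; toℕ-injective)
open import Data.Fin.Subset using (Subset; _∈_; ∣_∣; _∩_; _-_; inside; outside)
open import Data.Fin.Subset.Properties
  using (x∈p⇒∣p-x∣<∣p∣; x∈p∧x≢y⇒x∈p-y; x∈p∩q⁻; ∣p∩q∣≤∣p∣; ∣p∣≤n)
import Data.Integer.Base as ℤ
import Data.Integer.Properties as ℤ
open import Data.List.Base using (allFin; map)
open import Data.List.Extrema.Nat
  using (argmin; argmax; f[argmin]≤f[xs]; f[xs]≤f[argmax]; max≤v⁺)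
open import Data.List.Membership.Propositional.Properties using (∈-allFin)
open import Data.List.Properties using (map-tabulate)
import Data.List.Relation.Unary.All as All
import Data.List.Relation.Unary.All.Properties as All
open import Data.Nat.Base hiding (∣_-_∣)
open import Data.Nat.Divisibility using (_∣_; _∤_; >⇒∤; ∣m+n∣m⇒∣n; n∣m*n)
open import Data.Nat.DivMod
open import Data.Nat.ListAction using (sum)
open import Data.Nat.Primality using (Prime; euclidsLemma)
open import Data.Nat.Properties
open import Data.Nat.Tactic.RingSolver using (solve-∀)
open import Data.Product.Base using (_×_; _,_; ∃-syntax; proj₁; proj₂)
import Data.Rational.Base as ℚ
import Data.Rational.Properties as ℚ
open import Data.Rational.Unnormalised.Base using (mkℚᵘ; *≤*)
import Data.Rational.Unnormalised.Properties as ℚᵘ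
open import Data.Sum.Base using (_⊎_; inj₁; inj₂; [_,_]′)
open import Data.Vec.Base using ([]; _∷_; here; there)
open import Data.Vec.Properties using ([]=⇒lookup; lookup∘tabulate)
open import Function.Base using (_∘_; id; flip)
open import Function.Definitions using (Injective)
open import Relation.Binary.Definitions using (tri<; tri≈; tri>)
open import Relation.Binary.PropositionalEquality
open import Relation.Nullary.Decidable.Core using (Dec; yes; no)
open import Relation.Nullary.Negation.Core using (contradiction)

-- Finite sums and indicators.

∑ : ∀ n → (Fin n → ℕ) → ℕ
∑ n f = sum (map f (allFin n))

∑-suc : ∀ n (f : Fin (suc n) → ℕ) → ∑ (suc n) f ≡ f zero + ∑ n (f ∘ suc)
∑-suc n f = cong (λ xs → f zero + sum xs)
  (trans (map-tabulate suc f) (sym (map-tabulate id (f ∘ suc))))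

∑-mono : ∀ n {f g : Fin n → ℕ} → (∀ i → f i ≤ g i) → ∑ n f ≤ ∑ n g
∑-mono zero    f≤g = z≤n
∑-mono (suc n) {f} {g} f≤g rewrite ∑-suc n f | ∑-suc n g =
  +-mono-≤ (f≤g zero) (∑-mono n (f≤g ∘ suc))

∑-const : ∀ n c → ∑ n (λ _ → c) ≡ n * c
∑-const zero    c = refl
∑-const (suc n) c = trans (∑-suc n (λ _ → c)) (cong (c +_) (∑-const n c))

∑-bound : ∀ n {f : Fin n → ℕ} c → (∀ i → f i ≤ c) → ∑ n f ≤ n * c
∑-bound n c f≤c = ≤-trans (∑-mono n f≤c) (≤-reflexive (∑-const n c))

∑-+ : ∀ n (f g : Fin n → ℕ) → ∑ n (λ i → f i + g i) ≡ ∑ n f + ∑ n g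
∑-+ zero    f g = refl
∑-+ (suc n) f g
  rewrite ∑-suc n (λ i → f i + g i) | ∑-suc n f | ∑-suc n g | ∑-+ n (f ∘ suc) (g ∘ suc) =
  solve+ (f zero) (g zero) (∑ n (f ∘ suc)) (∑ n (g ∘ suc))
  where
  solve+ : ∀ a b c d → a + b + (c + d) ≡ a + c + (b + d)
  solve+ = solve-∀

∑-swap : ∀ m n (f : Fin m → Fin n → ℕ) →
         ∑ m (λ i → ∑ n (f i)) ≡ ∑ n (λ j → ∑ m (λ i → f i j))
∑-swap zero    n f = sym (trans (∑-const n 0) (*-zeroʳ n))
∑-swap (suc m) n f = begin
  ∑ (suc m) (λ i → ∑ n (f i))                       ≡⟨ ∑-suc m _ ⟩
  ∑ n (f zero) + ∑ m (λ i → ∑ n (f (suc i)))        ≡⟨ cong (∑ n (f zero) +_) (∑-swap m n (f ∘ suc)) ⟩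
  ∑ n (f zero) + ∑ n (λ j → ∑ m (λ i → f (suc i) j)) ≡⟨ ∑-+ n (f zero) _ ⟨
  ∑ n (λ j → f zero j + ∑ m (λ i → f (suc i) j))    ≡⟨ ∑-cong n (λ j → ∑-suc m (λ i → f i j)) ⟨
  ∑ n (λ j → ∑ (suc m) (λ i → f i j))               ∎
  where
  open ≡-Reasoning
  ∑-cong : ∀ n {f g : Fin n → ℕ} → (∀ i → f i ≡ g i) → ∑ n f ≡ ∑ n g
  ∑-cong n f≡g = ≤-antisym (∑-mono n (≤-reflexive ∘ f≡g)) (∑-mono n (≤-reflexive ∘ sym ∘ f≡g))

term≤∑ : ∀ n (f : Fin n → ℕ) i → f i ≤ ∑ n f
term≤∑ (suc n) f i rewrite ∑-suc n f with i
... | zero  = m≤m+n _ _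
... | suc i = ≤-trans (term≤∑ n (f ∘ suc) i) (m≤n+m _ _)

-- Used to turn a bin of `suc k` elements into `k` levels, each paid for by at least one short
-- vector.
count≤∑ : ∀ n k (f : Fin n → ℕ) → k ≤ n → (∀ i → toℕ i < k → 1 ≤ f i) → k ≤ ∑ n f
count≤∑ n       zero    f _         _  = z≤n
count≤∑ (suc n) (suc k) f (s≤s k≤n) 1≤ rewrite ∑-suc n f =
  +-mono-≤ (1≤ zero z<s) (count≤∑ n k (f ∘ suc) k≤n (λ i i<k → 1≤ (suc i) (s<s i<k)))

𝟙 : ∀ {P : Set} → Dec P → ℕ
𝟙 (yes _) = 1
𝟙 (no _)  = 0

𝟙-true : ∀ {P : Set} (P? : Dec P) → P → 𝟙 P? ≡ 1
𝟙-true (yes _) p = refl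
𝟙-true (no ¬p) p = contradiction p ¬p

∑𝟙≤1 : ∀ n {P : Fin n → Set} (P? : ∀ i → Dec (P i)) →
       (∀ i j → P i → P j → i ≡ j) → ∑ n (𝟙 ∘ P?) ≤ 1
∑𝟙≤1 zero    P? uniq = z≤n
∑𝟙≤1 (suc n) P? uniq rewrite ∑-suc n (𝟙 ∘ P?) with P? zero
... | no _  = ∑𝟙≤1 n (P? ∘ suc) (λ i j p q → Fin.suc-injective (uniq _ _ p q))
... | yes p = s≤s (≤-trans (∑-bound n 0 vanish) (≤-reflexive (*-zeroʳ n)))
  where
  vanish : ∀ i → 𝟙 (P? (suc i)) ≤ 0
  vanish i with P? (suc i)
  ... | no _  = z≤n
  ... | yes q = contradiction (uniq _ _ p q) λ ()

-- Σ_{L>s} 1/L² ≤ 1/s, with denominators cleared.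
∑-inverse-squares : ∀ Q n s (c : ℕ → ℕ) → (∀ L → L * L * c L ≤ Q) →
                    s * ∑ n (λ i → c (suc (s + toℕ i))) ≤ Q
∑-inverse-squares Q zero    s c hyp = ≤-trans (≤-reflexive (*-zeroʳ s)) z≤n
∑-inverse-squares Q (suc n) s c hyp
  rewrite ∑-suc n (λ i → c (suc (s + toℕ i))) | +-identityʳ s = *-cancelˡ-≤ (suc s) (begin
  -- Telescoping, 1/(s+1)² ≤ 1/s - 1/(s+1), after multiplying by `s` and `suc s`: the first term
  -- costs `Q` and the rest `s * Q`.
  suc s * (s * (C + T))                  ≡⟨ expand s C T ⟩
  s * suc s * C + s * (suc s * T)        ≤⟨ +-mono-≤ first (*-monoʳ-≤ s rest) ⟩
  Q + s * Q                              ∎)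
  where
  open ≤-Reasoning
  C = c (suc s)
  T = ∑ n (λ i → c (suc (s + suc (toℕ i))))
  expand : ∀ s C T → suc s * (s * (C + T)) ≡ s * suc s * C + s * (suc s * T)
  expand = solve-∀
  first : s * suc s * C ≤ Q
  first = ≤-trans (*-monoˡ-≤ C (*-monoˡ-≤ (suc s) (n≤1+n s))) (hyp (suc s))
  rest : suc s * T ≤ Q
  rest = ≤-trans (*-monoʳ-≤ (suc s) (∑-mono n λ i →
           ≤-reflexive (cong (c ∘ suc) (+-suc s (toℕ i)))))
         (∑-inverse-squares Q n (suc s) c hyp)

-- Subsets and injections.

index : ∀ {n} {T : Subset n} {x} → x ∈ T → Fin ∣ T ∣
index here = zero
index {T = inside  ∷ T} (there x∈T) = suc (index x∈T)
index {T = outside ∷ T} (there x∈T) = index x∈T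

index-injective : ∀ {n} {T : Subset n} {x y} (x∈T : x ∈ T) (y∈T : y ∈ T) →
                  index x∈T ≡ index y∈T → x ≡ y
index-injective here here _ = refl
index-injective {T = inside  ∷ T} (there p) (there q) eq =
  cong suc (index-injective p q (Fin.suc-injective eq))
index-injective {T = outside ∷ T} (there p) (there q) eq =
  cong suc (index-injective p q eq)
index-injective {T = inside ∷ T} here (there q) ()
index-injective {T = inside ∷ T} (there p) here ()

injective⇒≤∣∣ : ∀ {m n} (T : Subset n) (f : Fin m → Fin n) → Injective _≡_ _≡_ f →
                (∀ i → f i ∈ T) → m ≤ ∣ T ∣
injective⇒≤∣∣ T f inj f∈T = Fin.injective⇒≤ {f = index ∘ f∈T}
  (λ {i} {j} → inj ∘ index-injective (f∈T i) (f∈T j))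

enumerate : ∀ {n} (T : Subset n) →
            ∃[ e ] Injective _≡_ _≡_ e × (∀ (i : Fin ∣ T ∣) → e i ∈ T)
enumerate [] = (λ ()) , (λ {}) , λ ()
enumerate (outside ∷ T) with enumerate T
... | e , inj , e∈T = suc ∘ e , inj ∘ Fin.suc-injective , there ∘ e∈T
enumerate {suc n} (inside ∷ T) with enumerate T
... | e , inj , e∈T = e′ , inj′ , e′∈T
  where
  e′ : Fin (suc ∣ T ∣) → Fin (suc n)
  e′ zero    = zero
  e′ (suc i) = suc (e i)
  inj′ : Injective _≡_ _≡_ e′
  inj′ {zero}  {zero}  _  = refl
  inj′ {suc i} {suc j} eq = cong suc (inj (Fin.suc-injective eq))
  e′∈T : ∀ i → e′ i ∈ inside ∷ T
  e′∈T zero    = here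
  e′∈T (suc i) = there (e∈T i)

-- If `s` were missed, `T - s` would still contain `m` distinct values, although it has fewer than
-- `m` elements.
injective⇒surjective : ∀ {m n} (T : Subset n) (f : Fin m → Fin n) → Injective _≡_ _≡_ f →
                       (∀ i → f i ∈ T) → ∣ T ∣ ≡ m → ∀ {s} → s ∈ T → ∃[ i ] f i ≡ s
injective⇒surjective {m} T f inj f∈T ∣T∣≡m {s} s∈T with any? (λ i → f i Fin.≟ s)
... | yes found = found
... | no  ∄i    = contradiction (subst (_≤ ∣ T - s ∣) (sym ∣T∣≡m) (injective⇒≤∣∣ (T - s) f inj
                    λ i → x∈p∧x≢y⇒x∈p-y (f∈T i) (λ eq → ∄i (i , eq))))
                    (<⇒≱ (x∈p⇒∣p-x∣<∣p∣ s∈T))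

-- Pigeonhole on an interval.

/≡/⇒∸< : ∀ a b n .{{_ : NonZero n}} → a / n ≡ b / n → b ∸ a < n
/≡/⇒∸< a b n eq = begin-strict
  b ∸ a                                      ≡⟨ cong₂ _∸_ (m≡m%n+[m/n]*n b n) (m≡m%n+[m/n]*n a n) ⟩
  (b % n + b / n * n) ∸ (a % n + a / n * n)  ≡⟨ cong (λ q → (b % n + b / n * n) ∸ (a % n + q * n)) eq ⟩
  (b % n + b / n * n) ∸ (a % n + b / n * n)  ≡⟨ cong₂ _∸_ (+-comm (b % n) _) (+-comm (a % n) _) ⟩
  (b / n * n + b % n) ∸ (b / n * n + a % n)  ≡⟨ [m+n]∸[m+o]≡n∸o (b / n * n) (b % n) (a % n) ⟩
  b % n ∸ a % n                              ≤⟨ m∸n≤m (b % n) (a % n) ⟩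
  b % n                                      <⟨ m%n<n b n ⟩
  n                                          ∎
  where open ≤-Reasoning

-- Cut [0, D] into `K` cells by u ↦ ⌊uK/(D+1)⌋; two of the `K + 1` values share a cell.
close-pair : ∀ {K D} (u : Fin (suc K) → ℕ) → 1 ≤ K → Injective _≡_ _≡_ u → (∀ j → u j ≤ D) →
             ∃[ i ] ∃[ j ] u i < u j × (u j ∸ u i) * K ≤ D
close-pair {K} {D} u 1≤K inj u≤D =
  let i , j , i<j , eq = pigeonhole (n<1+n K) cell
      near = fromℕ<-injective _ _ (cell< i) (cell< j) eq
  in  order i j (λ uᵢ≡uⱼ → Fin.<⇒≢ i<j (inj uᵢ≡uⱼ)) near
  where
  -- The divisor `suc D` instead of `D` keeps the endpoint `D` inside the last cell.
  cell< : ∀ j → u j * K / suc D < K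
  cell< j = m<n*o⇒m/o<n (≤-trans (*-monoˡ-< K {{>-nonZero 1≤K}} (s≤s (u≤D j)))
                                (≤-reflexive (*-comm (suc D) K)))
  cell : Fin (suc K) → Fin K
  cell j = fromℕ< (cell< j)
  gap : ∀ i j → u i * K / suc D ≡ u j * K / suc D → (u j ∸ u i) * K ≤ D
  gap i j near = ≤-trans (≤-reflexive (*-distribʳ-∸ K (u j) (u i)))
                         (s≤s⁻¹ (/≡/⇒∸< (u i * K) (u j * K) (suc D) near))
  order : ∀ i j → u i ≢ u j → u i * K / suc D ≡ u j * K / suc D →
          ∃[ i ] ∃[ j ] u i < u j × (u j ∸ u i) * K ≤ D
  order i j uᵢ≢uⱼ near with <-cmp (u i) (u j)
  ... | tri< lt _ _ = i , j , lt , gap i j near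
  ... | tri≈ _ eq _ = contradiction eq uᵢ≢uⱼ
  ... | tri> _ _ gt = j , i , gt , gap j i (sym near)

-- Congruences modulo p.

module Congruence (p : ℕ) .{{_ : NonZero p}} where

  infix 4 _≈_

  _≈_ : ℕ → ℕ → Set
  a ≈ b = a % p ≡ b % p

  %-≈ : ∀ a → a % p ≈ a
  %-≈ a = m%n%n≡m%n a p

  +-cong : ∀ {a b c d} → a ≈ b → c ≈ d → a + c ≈ b + d
  +-cong {a} {b} {c} {d} e f = trans (%-distribˡ-+ a c p)
    (trans (cong₂ (λ x y → (x + y) % p) e f) (sym (%-distribˡ-+ b d p)))

  *-cong : ∀ {a b c d} → a ≈ b → c ≈ d → a * c ≈ b * d
  *-cong {a} {b} {c} {d} e f = trans (%-distribˡ-* a c p)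
    (trans (cong₂ (λ x y → (x * y) % p) e f) (sym (%-distribˡ-* b d p)))

  ∣⇒≈ : ∀ a {e} → p ∣ e → a ≈ a + e
  ∣⇒≈ a p∣e = sym (%-remove-+ʳ a p∣e)

  ≈⇒∣ : ∀ a e → a ≈ a + e → p ∣ e
  ≈⇒∣ a e eq = ∣m+n∣m⇒∣n
    (subst (p ∣_) (sym (+-cancelˡ-≡ (a % p) _ _ same)) (n∣m*n ((a + e) / p)))
    (n∣m*n (a / p))
    where
    same : a % p + (a / p * p + e) ≡ a % p + (a + e) / p * p
    same = begin
      a % p + (a / p * p + e)            ≡⟨ +-assoc (a % p) _ e ⟨
      a % p + a / p * p + e              ≡⟨ cong (_+ e) (m≡m%n+[m/n]*n a p) ⟨
      a + e                              ≡⟨ m≡m%n+[m/n]*n (a + e) p ⟩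
      (a + e) % p + (a + e) / p * p      ≡⟨ cong (_+ (a + e) / p * p) eq ⟨
      a % p + (a + e) / p * p            ∎
      where open ≡-Reasoning

  -- Common core of additive and multiplicative cancellation: ordering `a` and `b` and writing the
  -- larger as the smaller plus `e` reduces the congruence to p dividing `g e`, without subtraction.
  ≈-cancel : (f : ℕ → ℕ) (g : ℕ → ℕ) → (∀ a e → f (a + e) ≡ f a + g e) →
             (∀ e → p ∣ g e → p ∣ e) → ∀ a b → f a ≈ f b → a ≈ b
  ≈-cancel f g f-+ g-∣ a b eq =
    [ (λ a≤b → go a≤b eq) , (λ b≤a → sym (go b≤a (sym eq))) ]′ (≤-total a b)
    where
    go : ∀ {a b} → a ≤ b → f a ≈ f b → a ≈ b
    go {a} {b} a≤b eq with m≤n⇒∃[o]m+o≡n a≤b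
    ... | e , refl = ∣⇒≈ a (g-∣ e (≈⇒∣ (f a) (g e) (trans eq (cong (_% p) (f-+ a e)))))

  +-cancelˡ : ∀ c {a b} → c + a ≈ c + b → a ≈ b
  +-cancelˡ c {a} {b} = ≈-cancel (c +_) id (λ a e → sym (+-assoc c a e)) (λ _ → id) a b

  ≈⇒≡ : ∀ {a b} → a < p → b < p → a ≈ b → a ≡ b
  ≈⇒≡ a<p b<p eq = trans (sym (m<n⇒m%n≡m a<p)) (trans eq (m<n⇒m%n≡m b<p))

  ∤-small : ∀ {a} → 0 < a → a < p → p ∤ a
  ∤-small 0<a a<p = >⇒∤ {{>-nonZero 0<a}} a<p

  ∤-nonzero : ∀ (i : Fin p) → toℕ i ≢ 0 → p ∤ toℕ i
  ∤-nonzero i i≢0 = ∤-small (n≢0⇒n>0 i≢0) (toℕ<n i)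

  module _ (prime : Prime p) where

    *-cancelˡ : ∀ c {a b} → p ∤ c → c * a ≈ c * b → a ≈ b
    *-cancelˡ c {a} {b} p∤c = ≈-cancel (c *_) (c *_) (*-distribˡ-+ c)
      (λ e p∣ce → [ flip contradiction p∤c , id ]′ (euclidsLemma c e prime p∣ce)) a b

-- Bins, rationals and rounding.

∈preimage⇒≡ : ∀ {p m} (h : Fin p → Fin m) i {x} → x ∈ preimage h i → h x ≡ i
∈preimage⇒≡ h i {x} x∈ with trans (sym (lookup∘tabulate _ x)) ([]=⇒lookup x∈)
... | eq with h x Fin.≟ i
...   | yes hx≡i = hx≡i

lbin≤ : ∀ {p m} (h : Fin p → Fin m) S c → (∀ i → bin h S i ≤ c) → lbin h S ≤ c
lbin≤ h S c bin≤c = max≤v⁺ z≤n (All.map⁺ (All.universal bin≤c (allFin _)))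

/-≤ : ∀ s n c .{{_ : NonZero n}} → s ≤ c * n → (ℤ.+ s) ℚ./ n ℚ.≤ (ℤ.+ c) ℚ./ 1
/-≤ s (suc n) c s≤ = ℚ.toℚᵘ-cancel-≤ (begin
  ℚ.toℚᵘ (ℚ.fromℚᵘ (mkℚᵘ (ℤ.+ s) n)) ≃⟨ ℚ.toℚᵘ-fromℚᵘ (mkℚᵘ (ℤ.+ s) n) ⟩
  mkℚᵘ (ℤ.+ s) n                   ≤⟨ *≤* (subst₂ ℤ._≤_ (ℤ.pos-* s 1) (ℤ.pos-* c (suc n)) (ℤ.+≤+ s*1≤)) ⟩
  mkℚᵘ (ℤ.+ c) 0                   ≃⟨ ℚ.toℚᵘ-fromℚᵘ (mkℚᵘ (ℤ.+ c) 0) ⟨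
  ℚ.toℚᵘ (ℚ.fromℚᵘ (mkℚᵘ (ℤ.+ c) 0)) ∎)
  where
  open ℚᵘ.≤-Reasoning
  s*1≤ : s * 1 ≤ c * suc n
  s*1≤ = ≤-trans (≤-reflexive (*-identityʳ s)) s≤

toℕ-mod : ∀ k n .{{_ : NonZero n}} → toℕ (k mod n) ≡ k % n
toℕ-mod k n = toℕ-fromℕ< (m%n<n k n)

*≤⇒≤/ : ∀ {a b n} .{{_ : NonZero n}} → a * n ≤ b → a ≤ b / n
*≤⇒≤/ {a} {b} {n} an≤b = ≤-trans (≤-reflexive (sym (m*n/n≡m a n))) (/-monoˡ-≤ n an≤b)

-- Vector coordinates run from 1 while `Fin` runs from 0, hence the shift.
fromℕ<-suc : ∀ {n} k → 1 ≤ k → k ≤ n → ∃[ i ] suc (toℕ {n} i) ≡ k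
fromℕ<-suc (suc k) _ k<n = fromℕ< k<n , cong suc (toℕ-fromℕ< k<n)

-- Collinear lattice points and short vectors.

module LinearHashing (p m : ℕ) .{{_ : NonZero p}} .{{_ : NonZero m}}
                     (prime : Prime p) (m≤p : m ≤ p) where

  open Congruence p

  -- `J` indexes points of bin `c`: `x j` is a position in the progression, `y j` its hash before
  -- reduction mod `m`.
  module Collinear (A B c : ℕ) {J : Set} (x y : J → ℕ)
                   (x<m : ∀ j → x j < m) (y<p : ∀ j → y j < p)
                   (y≈ : ∀ j → y j ≈ A * x j + B) (y%m : ∀ j → y j % m ≡ c) where

    t : J → ℕ
    t j = y j / m

    τ : ℕ
    τ = pred p / m

    y≡ : ∀ j → y j ≡ c + m * t j
    y≡ j = trans (m≡m%n+[m/n]*n (y j) m) (cong₂ _+_ (y%m j) (*-comm (t j) m))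

    t≤τ : ∀ j → t j ≤ τ
    t≤τ j = /-monoˡ-≤ m (<⇒≤pred (y<p j))

    τ*m<p : τ * m < p
    τ*m<p = m≤pred[n]⇒suc[m]≤n (m/n*n≤m (pred p) m)

    -- Collinearity: both sides are congruent mod p, and at most (m - 1) τ < p.
    barycentre : ∀ k j l u w → x j ≡ x k + u → x l ≡ x j + w → u * t l + w * t k ≡ (u + w) * t j
    -- If `m` equals p it cannot be cancelled mod p, but then every `t` is 0.
    barycentre k j l u w xⱼ xₗ with m≤n⇒m<n∨m≡n m≤p
    ... | inj₂ refl = trans (cong₂ (λ a b → u * a + w * b) (t≡0 l) (t≡0 k))
                        (trans (zeros u w) (cong ((u + w) *_) (sym (t≡0 j))))
      where
      t≡0 : ∀ j → t j ≡ 0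
      t≡0 j = m<n⇒m/n≡0 (y<p j)
      zeros : ∀ u w → u * 0 + w * 0 ≡ (u + w) * 0
      zeros = solve-∀
    ... | inj₁ m<p = ≈⇒≡ (<p left) (<p right)
      (*-cancelˡ prime m (∤-small (>-nonZero⁻¹ m) m<p) (+-cancelˡ ((u + w) * c) scaled))
      where
      open ≤-Reasoning
      u+w<m : u + w < m
      u+w<m = begin-strict
        u + w         ≤⟨ m≤n+m (u + w) (x k) ⟩
        x k + (u + w) ≡⟨ +-assoc (x k) u w ⟨
        x k + u + w   ≡⟨ cong (_+ w) xⱼ ⟨
        x j + w       ≡⟨ xₗ ⟨
        x l           <⟨ x<m l ⟩
        m             ∎
      <p : ∀ {n} → n ≤ (u + w) * τ → n < p
      <p {n} n≤ = begin-strict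
        n           ≤⟨ n≤ ⟩
        (u + w) * τ ≤⟨ *-monoˡ-≤ τ (<⇒≤ u+w<m) ⟩
        m * τ       ≡⟨ *-comm m τ ⟩
        τ * m       <⟨ τ*m<p ⟩
        p           ∎
      left : u * t l + w * t k ≤ (u + w) * τ
      left = begin
        u * t l + w * t k ≤⟨ +-mono-≤ (*-monoʳ-≤ u (t≤τ l)) (*-monoʳ-≤ w (t≤τ k)) ⟩
        u * τ + w * τ     ≡⟨ *-distribʳ-+ τ u w ⟨
        (u + w) * τ       ∎
      right : (u + w) * t j ≤ (u + w) * τ
      right = *-monoʳ-≤ (u + w) (t≤τ j)
      affine : ∀ A B u w x → u * (A * (x + u + w) + B) + w * (A * x + B) ≡
                (u + w) * (A * (x + u) + B)
      affine = solve-∀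
      unfoldˡ : ∀ u w c m s t → (u + w) * c + m * (u * s + w * t) ≡
                u * (c + m * s) + w * (c + m * t)
      unfoldˡ = solve-∀
      unfoldʳ : ∀ v c m t → v * (c + m * t) ≡ v * c + m * (v * t)
      unfoldʳ = solve-∀
      y-affine : u * y l + w * y k ≈ (u + w) * y j
      y-affine = begin-equality
        (u * y l + w * y k) % p
          ≡⟨ +-cong (*-cong {u} refl (y≈ l)) (*-cong {w} refl (y≈ k)) ⟩
        (u * (A * x l + B) + w * (A * x k + B)) % p
          ≡⟨ cong (λ z → (u * (A * z + B) + w * (A * x k + B)) % p)
                  (trans xₗ (cong (_+ w) xⱼ)) ⟩
        (u * (A * (x k + u + w) + B) + w * (A * x k + B)) % p
          ≡⟨ cong (_% p) (affine A B u w (x k)) ⟩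
        ((u + w) * (A * (x k + u) + B)) % p
          ≡⟨ cong (λ z → ((u + w) * (A * z + B)) % p) xⱼ ⟨
        ((u + w) * (A * x j + B)) % p
          ≡⟨ *-cong {u + w} refl (y≈ j) ⟨
        ((u + w) * y j) % p ∎
      scaled : (u + w) * c + m * (u * t l + w * t k) ≈ (u + w) * c + m * ((u + w) * t j)
      scaled = begin-equality
        ((u + w) * c + m * (u * t l + w * t k)) % p   ≡⟨ cong (_% p) (unfoldˡ u w c m (t l) (t k)) ⟩
        (u * (c + m * t l) + w * (c + m * t k)) % p   ≡⟨ cong₂ (λ a b → (u * a + w * b) % p) (y≡ l) (y≡ k) ⟨
        (u * y l + w * y k) % p                       ≡⟨ y-affine ⟩
        ((u + w) * y j) % p                           ≡⟨ cong (λ z → ((u + w) * z) % p) (y≡ j) ⟩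
        ((u + w) * (c + m * t j)) % p                 ≡⟨ cong (_% p) (unfoldʳ (u + w) c m (t j)) ⟩
        ((u + w) * c + m * ((u + w) * t j)) % p       ∎

    -- The subtraction-free form of (u + d + w)(t j - t i) = d (t l - t k): the chord from `i` to
    -- `j` has the slope of the chord from `k` to `l`. It combines `barycentre` at `j` and at `i`
    -- with the same ends.
    slope : ∀ k i j l u d w → x i ≡ x k + u → x j ≡ x i + d → x l ≡ x j + w →
            (u + d + w) * t j + d * t k ≡ (u + d + w) * t i + d * t l
    slope k i j l u d w xᵢ xⱼ xₗ = begin
      (u + d + w) * t j + d * t k        ≡⟨ cong (_+ d * t k) (barycentre k j l (u + d) w xⱼ′ xₗ) ⟨
      (u + d) * t l + w * t k + d * t k  ≡⟨ regroup u d w (t l) (t k) ⟩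
      u * t l + (d + w) * t k + d * t l  ≡⟨ cong (_+ d * t l) (barycentre k i l u (d + w) xᵢ xₗ′) ⟩
      (u + (d + w)) * t i + d * t l      ≡⟨ cong (λ v → v * t i + d * t l) (+-assoc u d w) ⟨
      (u + d + w) * t i + d * t l        ∎
      where
      open ≡-Reasoning
      xⱼ′ : x j ≡ x k + (u + d)
      xⱼ′ = trans xⱼ (trans (cong (_+ d) xᵢ) (+-assoc (x k) u d))
      xₗ′ : x l ≡ x i + (d + w)
      xₗ′ = trans xₗ (trans (cong (_+ w) xⱼ) (+-assoc (x i) d w))
      regroup : ∀ u d w a b → (u + d) * a + w * b + d * b ≡ u * a + (d + w) * b + d * a
      regroup = solve-∀

    -- The slope equation gives D e ≤ d b. As `d` is at most `D / K`, the vertical gap `e` is at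
    -- most `τ / K`.
    steep : ∀ {K D d s a b e} → d * K ≤ D → 1 ≤ D → D * (a + e) + d * s ≡ D * a + d * b →
            b ≤ τ → e * K ≤ τ
    steep {K} {D} {d} {s} {a} {b} {e} dK≤D 1≤D eq b≤τ = *-cancelˡ-≤ D {{>-nonZero 1≤D}} (begin
      D * (e * K)    ≡⟨ *-assoc D e K ⟨
      D * e * K      ≤⟨ *-monoˡ-≤ K De≤db ⟩
      d * b * K      ≡⟨ swap d b K ⟩
      d * K * b      ≤⟨ *-mono-≤ dK≤D b≤τ ⟩
      D * τ          ∎)
      where
      open ≤-Reasoning
      swap : ∀ d b K → d * b * K ≡ d * K * b
      swap = solve-∀
      De≤db : D * e ≤ d * b
      De≤db = +-cancelˡ-≤ (D * a) _ _ (begin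
        D * a + D * e           ≡⟨ *-distribˡ-+ D a e ⟨
        D * (a + e)             ≤⟨ m≤m+n _ (d * s) ⟩
        D * (a + e) + d * s     ≡⟨ eq ⟩
        D * a + d * b           ∎)

    -- Both sides are the increment from `y i` to `y j`, computed once from `y≈` and once from `y≡`.
    rise : ∀ i j d e → x j ≡ x i + d → t j ≡ t i + e → A * d ≈ m * e
    rise i j d e xⱼ tⱼ = +-cancelˡ (y i) (begin
      (y i + A * d) % p               ≡⟨ +-cong (y≈ i) refl ⟩
      (A * x i + B + A * d) % p       ≡⟨ cong (_% p) (shift A (x i) B d) ⟩
      (A * (x i + d) + B) % p         ≡⟨ cong (λ z → (A * z + B) % p) xⱼ ⟨
      (A * x j + B) % p               ≡⟨ y≈ j ⟨
      y j % p                         ≡⟨ cong (_% p) (y≡ j) ⟩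
      (c + m * t j) % p               ≡⟨ cong (λ z → (c + m * z) % p) tⱼ ⟩
      (c + m * (t i + e)) % p         ≡⟨ cong (_% p) (split c m (t i) e) ⟩
      (c + m * t i + m * e) % p       ≡⟨ cong (λ z → (z + m * e) % p) (y≡ i) ⟨
      (y i + m * e) % p               ∎)
      where
      open ≡-Reasoning
      shift : ∀ A x B d → A * x + B + A * d ≡ A * (x + d) + B
      shift = solve-∀
      split : ∀ c m t e → c + m * (t + e) ≡ c + m * t + m * e
      split = solve-∀

    -- Here the lattice vector is (d , - e); the negative term is moved across to stay in ℕ.
    fall : ∀ i j d e → x j ≡ x i + d → t i ≡ t j + e → A * d + m * e ≈ 0
    fall i j d e xⱼ tᵢ = +-cancelˡ (y j) (begin
      (y j + (A * d + m * e)) % p            ≡⟨ cong (λ z → (z + (A * d + m * e)) % p) (y≡ j) ⟩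
      (c + m * t j + (A * d + m * e)) % p    ≡⟨ cong (_% p) (split c m (t j) e (A * d)) ⟩
      (c + m * (t j + e) + A * d) % p        ≡⟨ cong (λ z → (c + m * z + A * d) % p) tᵢ ⟨
      (c + m * t i + A * d) % p              ≡⟨ cong (λ z → (z + A * d) % p) (y≡ i) ⟨
      (y i + A * d) % p                      ≡⟨ +-cong (y≈ i) refl ⟩
      (A * x i + B + A * d) % p              ≡⟨ cong (_% p) (shift A (x i) B d) ⟩
      (A * (x i + d) + B) % p                ≡⟨ cong (λ z → (A * z + B) % p) xⱼ ⟨
      (A * x j + B) % p                      ≡⟨ y≈ j ⟨
      y j % p                                ≡⟨ cong (_% p) (+-identityʳ (y j)) ⟨
      (y j + 0) % p                          ∎)
      where
      open ≡-Reasoning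
      shift : ∀ A x B d → A * x + B + A * d ≡ A * (x + d) + B
      shift = solve-∀
      split : ∀ c m t e n → c + m * t + (n + m * e) ≡ c + m * (t + e) + n
      split = solve-∀

  -- The two alternatives are the signs of the second coordinate. The case `e = 0` is excluded
  -- later, by `nonhorizontal`.
  ShortVector : ℕ → ℕ → Set
  ShortVector A K = ∃[ d ] ∃[ e ] 1 ≤ d × d * K ≤ pred m × e * K ≤ pred p / m ×
                  (A * d ≈ m * e ⊎ A * d + m * e ≈ 0)

  short-vector : ∀ {A B c K} (x y : Fin (suc K) → ℕ) → 1 ≤ K → Injective _≡_ _≡_ x →
                 (∀ j → x j < m) → (∀ j → y j < p) →
                 (∀ j → y j ≈ A * x j + B) → (∀ j → y j % m ≡ c) → ShortVector A K
  short-vector {A} {B} {c} {K} x y 1≤K inj x<m y<p y≈ y%m =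
    -- The pigeonhole runs over the actual spread `D` of the bin, not over `m - 1`, because `steep`
    -- compares the pair with the chord from `lo` to `hi`.
    let i , j , uᵢ<uⱼ , dK≤D = close-pair u 1≤K u-inj (λ j → ∸-monoˡ-≤ (x lo) (≤hi j))
    in  vector i j uᵢ<uⱼ dK≤D (≤-total (t i) (t j))
    where
    open Collinear A B c x y x<m y<p y≈ y%m
    lo hi : Fin (suc K)
    lo = argmin x zero (allFin _)
    hi = argmax x zero (allFin _)
    lo≤ : ∀ j → x lo ≤ x j
    lo≤ j = All.lookup (f[argmin]≤f[xs] {f = x} zero (allFin _)) (∈-allFin j)
    ≤hi : ∀ j → x j ≤ x hi
    ≤hi j = All.lookup (f[xs]≤f[argmax] {f = x} zero (allFin _)) (∈-allFin j)
    u : Fin (suc K) → ℕ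
    u j = x j ∸ x lo
    u-inj : Injective _≡_ _≡_ u
    u-inj eq = inj (∸-cancelʳ-≡ (lo≤ _) (lo≤ _) eq)
    D = x hi ∸ x lo
    vector : ∀ i j → u i < u j → (u j ∸ u i) * K ≤ D → t i ≤ t j ⊎ t j ≤ t i → ShortVector A K
    vector i j uᵢ<uⱼ dK≤D = λ where
        (inj₁ tᵢ≤tⱼ) → let tⱼ = sym (m+[n∸m]≡n tᵢ≤tⱼ) in
          d , t j ∸ t i , m<n⇒0<n∸m uᵢ<uⱼ , dK<m ,
          steep {d = d} (subst (d * K ≤_) D≡ dK≤D) 1≤D
            (trans (cong (λ z → D′ * z + d * t lo) (sym tⱼ)) line) (t≤τ hi) ,
          inj₁ (rise i j d _ xⱼ tⱼ)
        -- For a falling pair `line` is read backwards, so `lo` and `hi` exchange roles in `steep`.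
        (inj₂ tⱼ≤tᵢ) → let tᵢ = sym (m+[n∸m]≡n tⱼ≤tᵢ) in
          d , t i ∸ t j , m<n⇒0<n∸m uᵢ<uⱼ , dK<m ,
          steep {d = d} (subst (d * K ≤_) D≡ dK≤D) 1≤D
            (trans (cong (λ z → D′ * z + d * t hi) (sym tᵢ)) (sym line)) (t≤τ lo) ,
          inj₂ (fall i j d _ xⱼ tᵢ)
      where
      d = u j ∸ u i
      w = x hi ∸ x j
      D′ = u i + d + w
      xᵢ : x i ≡ x lo + u i
      xᵢ = sym (m+[n∸m]≡n (lo≤ i))
      u+d : u i + d ≡ u j
      u+d = m+[n∸m]≡n (<⇒≤ uᵢ<uⱼ)
      xⱼ : x j ≡ x i + d
      xⱼ = begin
        x j              ≡⟨ m+[n∸m]≡n (lo≤ j) ⟨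
        x lo + u j       ≡⟨ cong (x lo +_) u+d ⟨
        x lo + (u i + d) ≡⟨ +-assoc (x lo) (u i) d ⟨
        x lo + u i + d   ≡⟨ cong (_+ d) xᵢ ⟨
        x i + d          ∎
        where open ≡-Reasoning
      xₗ : x hi ≡ x j + w
      xₗ = sym (m+[n∸m]≡n (≤hi j))
      D≡ : D ≡ D′
      D≡ = begin
        x hi ∸ x lo        ≡⟨ cong (_∸ x lo) xₗ ⟩
        x j + w ∸ x lo     ≡⟨ +-∸-comm w (lo≤ j) ⟩
        u j + w            ≡⟨ cong (_+ w) u+d ⟨
        u i + d + w        ∎
        where open ≡-Reasoning
      1≤D : 1 ≤ D′
      1≤D = ≤-trans (m<n⇒0<n∸m uᵢ<uⱼ) (≤-trans (m≤n+m d (u i)) (m≤m+n (u i + d) w))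
      dK<m : d * K ≤ pred m
      dK<m = ≤-trans dK≤D (≤-trans (m∸n≤m (x hi) (x lo)) (<⇒≤pred (x<m hi)))
      line : D′ * t j + d * t lo ≡ D′ * t i + d * t hi
      line = slope lo i j hi (u i) d w xᵢ xⱼ xₗ

  -- Counting multipliers through short vectors.

  short? : ℕ → ℕ → ℕ → ℕ
  short? A d e = 𝟙 (A * d % p ≟ m * e % p) + 𝟙 ((A * d + m * e) % p ≟ 0 % p)

  -- The number of lattice vectors (d , ± e) for `A` in the box shrunk by `L`, with both coordinates
  -- nonzero.
  shorts : ℕ → ∀ L .{{_ : NonZero L}} → ℕ
  shorts A L = ∑ (pred m / L) λ d → ∑ (pred p / m / L) λ e → short? A (suc (toℕ d)) (suc (toℕ e))

  pred-m<p : pred m < p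
  pred-m<p = ≤-trans (m≤pred[n]⇒suc[m]≤n ≤-refl) m≤p

  1≤short? : ∀ A d e → A * d ≈ m * e ⊎ A * d + m * e ≈ 0 → 1 ≤ short? A d e
  1≤short? A d e (inj₁ eq) =
    ≤-trans (≤-reflexive (sym (𝟙-true (A * d % p ≟ m * e % p) eq))) (m≤m+n _ _)
  1≤short? A d e (inj₂ eq) =
    ≤-trans (≤-reflexive (sym (𝟙-true ((A * d + m * e) % p ≟ 0 % p) eq))) (m≤n+m _ _)

  -- With `e = 0` the prime p would divide `A * d`. This lets `shorts` start at `e = 1`, so that its
  -- box shrinks in both directions.
  nonhorizontal : ∀ {A d e} → p ∤ A → p ∤ d → A * d ≈ m * e ⊎ A * d + m * e ≈ 0 → 1 ≤ e
  nonhorizontal {e = suc e} _ _ _ = s≤s z≤n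
  nonhorizontal {A} {d} {zero} p∤A p∤d eq =
    contradiction (euclidsLemma A d prime (≈⇒∣ 0 (A * d) (sym (A*d≈0 eq)))) [ p∤A , p∤d ]′
    where
    A*d≈0 : A * d ≈ m * 0 ⊎ A * d + m * 0 ≈ 0 → A * d ≈ 0
    A*d≈0 (inj₁ eq) = trans eq (cong (_% p) (*-zeroʳ m))
    A*d≈0 (inj₂ eq) = trans
      (cong (_% p) (sym (trans (cong (A * d +_) (*-zeroʳ m)) (+-identityʳ (A * d))))) eq

  -- A vector short for `K` is short for every smaller `L`, so one vector serves all levels up to
  -- `K`.
  ShortVector⇒1≤shorts : ∀ {A K} → ShortVector A K → p ∤ A →
                         ∀ L .{{_ : NonZero L}} → L ≤ K → 1 ≤ shorts A L
  ShortVector⇒1≤shorts {A} {K} (d , e , 1≤d , dK≤ , eK≤ , eq) p∤A L L≤K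
    with fromℕ<-suc d 1≤d (*≤⇒≤/ {n = L} (≤-trans (*-monoʳ-≤ d L≤K) dK≤))
       | fromℕ<-suc e (nonhorizontal p∤A p∤d eq) (*≤⇒≤/ {n = L} (≤-trans (*-monoʳ-≤ e L≤K) eK≤))
    where
    p∤d : p ∤ d
    p∤d = ∤-small 1≤d (≤-<-trans (m≤m*n d K {{>-nonZero (≤-trans (>-nonZero⁻¹ L) L≤K)}})
                                 (≤-<-trans dK≤ pred-m<p))
  ... | i , refl | j , refl =
    ≤-trans (1≤short? A d e eq) (≤-trans (term≤∑ (pred p / m / L) _ j) (term≤∑ (pred m / L) row i))
    where
    row : Fin (pred m / L) → ℕ
    row d = ∑ (pred p / m / L) λ e → short? A (suc (toℕ d)) (suc (toℕ e))

  -- A linear equation in α whose coefficient `a * d` is invertible mod p. The two signs are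
  -- `c = 0`, `r = m * e` and `c = m * e`, `r = 0`.
  unique-residue : ∀ a d r c → p ∤ a → p ∤ d → ∀ (α α′ : Fin p) →
                   toℕ α * a * d + c ≈ r → toℕ α′ * a * d + c ≈ r → α ≡ α′
  unique-residue a d r c p∤a p∤d α α′ e e′ = toℕ-injective (≈⇒≡ (toℕ<n α) (toℕ<n α′)
    (*-cancelˡ prime (a * d) (λ p∣ad → [ p∤a , p∤d ]′ (euclidsLemma a d prime p∣ad))
      (+-cancelˡ c (trans (cong (_% p) (reorder (toℕ α) a d c))
                   (trans (trans e (sym e′)) (cong (_% p) (sym (reorder (toℕ α′) a d c))))))))
    where
    reorder : ∀ α a d c → c + a * d * α ≡ α * a * d + c
    reorder = solve-∀

  ∑short?≤2 : ∀ a d e → p ∤ a → p ∤ d → ∑ p (λ α → short? (toℕ α * a) d e) ≤ 2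
  ∑short?≤2 a d e p∤a p∤d = ≤-trans (≤-reflexive (∑-+ p (𝟙 ∘ rising?) (𝟙 ∘ falling?))) (+-mono-≤
    (∑𝟙≤1 p rising? λ α α′ eq eq′ →
      unique-residue a d (m * e) 0 p∤a p∤d α α′ (pad α eq) (pad α′ eq′))
    (∑𝟙≤1 p falling? (unique-residue a d 0 (m * e) p∤a p∤d)))
    where
    rising? : ∀ α → Dec (toℕ α * a * d ≈ m * e)
    rising? α = toℕ α * a * d % p ≟ m * e % p
    falling? : ∀ α → Dec (toℕ α * a * d + m * e ≈ 0)
    falling? α = (toℕ α * a * d + m * e) % p ≟ 0 % p
    pad : ∀ α → toℕ α * a * d ≈ m * e → toℕ α * a * d + 0 ≈ m * e
    pad α = trans (cong (_% p) (+-identityʳ (toℕ α * a * d)))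

  area : ∀ L .{{_ : NonZero L}} → ℕ
  area L = pred m / L * (pred p / m / L * 2)

  -- Double counting: for each fixed (d , e), each sign admits at most one α.
  ∑shorts≤area : ∀ a → p ∤ a → ∀ L .{{_ : NonZero L}} → ∑ p (λ α → shorts (toℕ α * a) L) ≤ area L
  ∑shorts≤area a p∤a L = begin
    ∑ p (λ α → ∑ X λ d → ∑ Y λ e → f α d e)    ≡⟨ ∑-swap p X _ ⟩
    ∑ X (λ d → ∑ p λ α → ∑ Y λ e → f α d e)    ≤⟨ ∑-bound X (Y * 2) row ⟩
    X * (Y * 2)                                ∎
    where
    open ≤-Reasoning
    X = pred m / L
    Y = pred p / m / L
    f : Fin p → Fin X → Fin Y → ℕ
    f α d e = short? (toℕ α * a) (suc (toℕ d)) (suc (toℕ e))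
    p∤d : ∀ (d : Fin X) → p ∤ suc (toℕ d)
    p∤d d = ∤-small z<s (≤-<-trans (≤-trans (toℕ<n d) (m/n≤m (pred m) L)) pred-m<p)
    row : ∀ d → ∑ p (λ α → ∑ Y λ e → f α d e) ≤ Y * 2
    row d = begin
      ∑ p (λ α → ∑ Y λ e → f α d e)   ≡⟨ ∑-swap p Y _ ⟩
      ∑ Y (λ e → ∑ p λ α → f α d e)   ≤⟨ ∑-bound Y 2 (λ e → ∑short?≤2 a _ _ p∤a (p∤d d)) ⟩
      Y * 2                           ∎

  -- Each factor `L` is absorbed by one rounded-down side; the unshrunk sides have product below p,
  -- and the 2 counts signs.
  area-bound : ∀ L .{{_ : NonZero L}} → L * L * area L ≤ 2 * p
  area-bound L = begin
    L * L * (X * (Y * 2))   ≡⟨ regroup L X Y ⟩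
    2 * ((X * L) * (Y * L)) ≤⟨ *-monoʳ-≤ 2 (*-mono-≤ (m/n*n≤m (pred m) L) (m/n*n≤m (pred p / m) L)) ⟩
    2 * (pred m * (pred p / m)) ≤⟨ *-monoʳ-≤ 2 (*-monoˡ-≤ (pred p / m) (pred[n]≤n {m})) ⟩
    2 * (m * (pred p / m))  ≡⟨ cong (2 *_) (*-comm m (pred p / m)) ⟩
    2 * (pred p / m * m)    ≤⟨ *-monoʳ-≤ 2 (≤-trans (m/n*n≤m (pred p) m) (pred[n]≤n {p})) ⟩
    2 * p                   ∎
    where
    open ≤-Reasoning
    X = pred m / L
    Y = pred p / m / L
    regroup : ∀ L X Y → L * L * (X * (Y * 2)) ≡ 2 * ((X * L) * (Y * L))
    regroup = solve-∀

  ∑area≤ : ∀ n → ∑ n (λ ℓ → area (suc (toℕ ℓ))) ≤ 4 * p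
  ∑area≤ zero    = z≤n
  ∑area≤ (suc n) = begin
    ∑ (suc n) (λ ℓ → area (suc (toℕ ℓ)))            ≡⟨ ∑-suc n _ ⟩
    area 1 + ∑ n (λ ℓ → area (suc (suc (toℕ ℓ))))
      -- Level 1 is split off because the tail estimate says nothing at `s = 0`.
      ≤⟨ +-mono-≤ (1*≤ (area-bound 1)) (1*≤ (∑-inverse-squares (2 * p) n 1 c bound)) ⟩
    2 * p + 2 * p                                   ≡⟨ *-distribʳ-+ p 2 2 ⟨
    4 * p                                           ∎
    where
    open ≤-Reasoning
    1*≤ : ∀ {a b} → 1 * a ≤ b → a ≤ b
    1*≤ {a} = ≤-trans (≤-reflexive (sym (*-identityˡ a)))
    c : ℕ → ℕ
    c zero    = 0
    c (suc L) = area (suc L)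
    bound : ∀ L → L * L * c L ≤ 2 * p
    bound zero    = z≤n
    bound (suc L) = area-bound (suc L)

  -- Bin loads of an arithmetic progression.

  module _ (S : Subset p) (∣S∣≡m : ∣ S ∣ ≡ m) (a b : Fin p) (a≢0 : toℕ a ≢ 0)
           (AP⊆S : (x : Fin m) → ((toℕ a * toℕ x + toℕ b) mod p) ∈ S) where

    ap : Fin m → Fin p
    ap x = (toℕ a * toℕ x + toℕ b) mod p

    p∤a : p ∤ toℕ a
    p∤a = ∤-nonzero a a≢0

    ap-injective : Injective _≡_ _≡_ ap
    ap-injective {x} {x′} eq = toℕ-injective (≈⇒≡ (x<p x) (x<p x′) (*-cancelˡ prime (toℕ a) p∤a
      (+-cancelˡ (toℕ b) (begin
        (toℕ b + toℕ a * toℕ x) % p   ≡⟨ cong (_% p) (+-comm (toℕ b) _) ⟩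
        (toℕ a * toℕ x + toℕ b) % p   ≡⟨ toℕ-mod _ p ⟨
        toℕ (ap x)                    ≡⟨ cong toℕ eq ⟩
        toℕ (ap x′)                   ≡⟨ toℕ-mod _ p ⟩
        (toℕ a * toℕ x′ + toℕ b) % p  ≡⟨ cong (_% p) (+-comm (toℕ b) _) ⟨
        (toℕ b + toℕ a * toℕ x′) % p  ∎))))
      where
      open ≡-Reasoning
      x<p : ∀ (x : Fin m) → toℕ x < p
      x<p x = ≤-trans (toℕ<n x) m≤p

    -- Since `ap` reaches all of `S`, every element of the bin has a position x, and its hash before
    -- reduction mod `m` is affine in x mod p, with slope αa and offset αb + β.
    bin-ShortVector : ∀ α β i {K} → 1 ≤ K → bin (hash p m α β) S i ≡ suc K →
                      ShortVector (toℕ α * toℕ a) K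
    bin-ShortVector α β i {K} 1≤K eq with enumerate (S ∩ preimage (hash p m α β) i)
    ... | e , e-inj , e∈ rewrite eq =
      short-vector {A = toℕ α * toℕ a} {B = toℕ α * toℕ b + toℕ β} {c = toℕ i}
        (λ j → toℕ (x j)) y 1≤K
        (λ {j} {k} x≡ → e-inj (trans (sym (ap-x j)) (trans (cong ap (toℕ-injective x≡)) (ap-x k))))
        (λ j → toℕ<n (x j)) (λ j → m%n<n _ p) y≈ y%m
      where
      h = hash p m α β
      preimage-ap : ∀ j → ∃[ x ] ap x ≡ e j
      preimage-ap j = injective⇒surjective S ap ap-injective AP⊆S ∣S∣≡m
        (proj₁ (x∈p∩q⁻ S (preimage h i) (e∈ j)))
      x : Fin (suc K) → Fin m
      x j = proj₁ (preimage-ap j)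
      ap-x : ∀ j → ap (x j) ≡ e j
      ap-x j = proj₂ (preimage-ap j)
      y : Fin (suc K) → ℕ
      y j = (toℕ α * toℕ (e j) + toℕ β) % p
      y%m : ∀ j → y j % m ≡ toℕ i
      y%m j = trans (sym (toℕ-mod (y j) m))
        (cong toℕ (∈preimage⇒≡ h i (proj₂ (x∈p∩q⁻ S (preimage h i) (e∈ j)))))
      expand : ∀ α β a b x → α * (a * x + b) + β ≡ α * a * x + (α * b + β)
      expand = solve-∀
      y≈ : ∀ j → y j ≈ toℕ α * toℕ a * toℕ (x j) + (toℕ α * toℕ b + toℕ β)
      y≈ j = begin
        y j % p
          ≡⟨ %-≈ (toℕ α * toℕ (e j) + toℕ β) ⟩
        (toℕ α * toℕ (e j) + toℕ β) % p
          ≡⟨ cong (λ z → (toℕ α * toℕ z + toℕ β) % p) (ap-x j) ⟨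
        (toℕ α * toℕ (ap (x j)) + toℕ β) % p
          ≡⟨ cong (λ z → (toℕ α * z + toℕ β) % p) (toℕ-mod _ p) ⟩
        (toℕ α * ((toℕ a * toℕ (x j) + toℕ b) % p) + toℕ β) % p
          ≡⟨ +-cong (*-cong {toℕ α} refl (%-≈ _)) refl ⟩
        (toℕ α * (toℕ a * toℕ (x j) + toℕ b) + toℕ β) % p
          ≡⟨ cong (_% p) (expand (toℕ α) (toℕ β) (toℕ a) (toℕ b) (toℕ (x j))) ⟩
        (toℕ α * toℕ a * toℕ (x j) + (toℕ α * toℕ b + toℕ β)) % p ∎
        where open ≡-Reasoning

    bin≤m : ∀ α β i → bin (hash p m α β) S i ≤ m
    bin≤m α β i = ≤-trans (∣p∩q∣≤∣p∣ S (preimage (hash p m α β) i)) (≤-reflexive ∣S∣≡m)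

    -- Depends on α alone, so that it bounds all bins and all β at once.
    load : Fin p → ℕ
    load α = ∑ (pred m) λ ℓ → shorts (toℕ α * toℕ a) (suc (toℕ ℓ))

    -- Layer-cake count: a bin of `suc K` elements has a short vector at each level 1, ..., K, and
    -- `K ≤ m - 1`. The first element is the extra 1.
    bin≤1+load : ∀ α β i → toℕ α ≢ 0 → bin (hash p m α β) S i ≤ suc (load α)
    bin≤1+load α β i α≢0 with bin (hash p m α β) S i in eq
    ... | zero  = z≤n
    ... | suc K = s≤s (count≤∑ (pred m) K _ (<⇒≤pred (subst (_≤ m) eq (bin≤m α β i)))
      λ ℓ ℓ<K → ShortVector⇒1≤shorts
        (bin-ShortVector α β i (≤-trans (s≤s z≤n) ℓ<K) eq) p∤αa (suc (toℕ ℓ)) ℓ<K)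
      where
      p∤αa : p ∤ toℕ α * toℕ a
      p∤αa p∣αa = [ ∤-nonzero α α≢0 , p∤a ]′ (euclidsLemma (toℕ α) (toℕ a) prime p∣αa)

    -- p · [α = 0], written as a sum so that it can be exchanged with ∑ over α.
    degenerate : Fin p → ℕ
    degenerate α = ∑ p λ _ → 𝟙 (toℕ α ≟ 0)

    -- For α = 0 the hash is constant in x; the trivial bound p is then covered by `degenerate`.
    lbin≤load : ∀ α β → lbin (hash p m α β) S ≤ degenerate α + suc (load α)
    lbin≤load α β with toℕ α ≟ 0
    ... | no α≢0 = lbin≤ (hash p m α β) S _ λ i → ≤-trans (bin≤1+load α β i α≢0) (m≤n+m _ _)
    ... | yes _  = lbin≤ (hash p m α β) S _ λ i → begin
      bin (hash p m α β) S i          ≤⟨ bin≤m α β i ⟩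
      m                               ≤⟨ m≤p ⟩
      p                               ≡⟨ *-identityʳ p ⟨
      p * 1                           ≡⟨ ∑-const p 1 ⟨
      ∑ p (λ _ → 1)                   ≤⟨ m≤m+n _ _ ⟩
      ∑ p (λ _ → 1) + suc (load α)    ∎
      where open ≤-Reasoning

    -- Averaging over α and β.

    ∑degenerate≤p : ∑ p degenerate ≤ p
    ∑degenerate≤p = begin
      ∑ p degenerate                          ≡⟨ ∑-swap p p (λ α _ → 𝟙 (toℕ α ≟ 0)) ⟩
      ∑ p (λ _ → ∑ p (λ α → 𝟙 (toℕ α ≟ 0)))   ≤⟨ ∑-bound p 1 (λ _ → one-zero) ⟩
      p * 1                                   ≡⟨ *-identityʳ p ⟩
      p                                       ∎
      where
      open ≤-Reasoning
      one-zero : ∑ p (λ α → 𝟙 (toℕ α ≟ 0)) ≤ 1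
      one-zero = ∑𝟙≤1 p (λ α → toℕ α ≟ 0) λ α α′ e e′ → toℕ-injective (trans e (sym e′))

    -- Exchanging the sums bounds each level by its `area`, and the areas decay like 1 / L².
    ∑load≤4p : ∑ p load ≤ 4 * p
    ∑load≤4p = begin
      ∑ p load
        ≡⟨ ∑-swap p (pred m) _ ⟩
      ∑ (pred m) (λ ℓ → ∑ p λ α → shorts (toℕ α * toℕ a) (suc (toℕ ℓ)))
        ≤⟨ ∑-mono (pred m) (λ ℓ → ∑shorts≤area (toℕ a) p∤a (suc (toℕ ℓ))) ⟩
      ∑ (pred m) (λ ℓ → area (suc (toℕ ℓ)))
        ≤⟨ ∑area≤ (pred m) ⟩
      4 * p ∎
      where open ≤-Reasoning

    -- For each β, 6 = 1 + 1 + 4: the multiplier α = 0, the first element of a bin, and the short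
    -- vectors.
    ∑lbin≤6p² : ∑ p (λ α → ∑ p λ β → lbin (hash p m α β) S) ≤ 6 * p ^ 2
    ∑lbin≤6p² = begin
      ∑ p (λ α → ∑ p λ β → lbin (hash p m α β) S)    ≡⟨ ∑-swap p p _ ⟩
      ∑ p (λ β → ∑ p λ α → lbin (hash p m α β) S)    ≤⟨ ∑-bound p (6 * p) column ⟩
      p * (6 * p)                                    ≡⟨ square p ⟩
      6 * p ^ 2                                      ∎
      where
      open ≤-Reasoning
      square : ∀ p → p * (6 * p) ≡ 6 * (p * (p * 1))
      square = solve-∀
      collect : ∀ p → p + (p * 1 + 4 * p) ≡ 6 * p
      collect = solve-∀
      column : ∀ β → ∑ p (λ α → lbin (hash p m α β) S) ≤ 6 * p
      column β = begin
        ∑ p (λ α → lbin (hash p m α β) S)            ≤⟨ ∑-mono p (λ α → lbin≤load α β) ⟩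
        ∑ p (λ α → degenerate α + suc (load α))      ≡⟨ ∑-+ p degenerate _ ⟩
        ∑ p degenerate + ∑ p (λ α → 1 + load α)      ≡⟨ cong (∑ p degenerate +_) (∑-+ p (λ _ → 1) load) ⟩
        ∑ p degenerate + (∑ p (λ _ → 1) + ∑ p load)  ≤⟨ +-mono-≤ ∑degenerate≤p
                                                           (+-mono-≤ (≤-reflexive (∑-const p 1)) ∑load≤4p) ⟩
        p + (p * 1 + 4 * p)                          ≡⟨ collect p ⟩
        6 * p                                        ∎

corollary3 : ∃[ C ] ((p m : ℕ) .{{_ : NonZero p}} .{{_ : NonZero m}} → Prime p →
    (S : Subset p) → ∣ S ∣ ≡ m →
    (a b : Fin p) → toℕ a ≢ 0 →
    ((x : Fin m) → ((toℕ a * toℕ x + toℕ b) mod p) ∈ S) →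
    𝔼-lbin p m S ℚ.≤ C)
corollary3 = (ℤ.+ 6) ℚ./ 1 , λ p m prime S ∣S∣≡m a b a≢0 AP⊆S →
  /-≤ _ (p ^ 2) 6 {{m^n≢0 p 2}}
    (LinearHashing.∑lbin≤6p² p m prime (subst (_≤ p) ∣S∣≡m (∣p∣≤n S)) S ∣S∣≡m a b a≢0 AP⊆S)
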